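{- Let $G$ be a ribbon digraph with vertex set $V$, and let $(x,\varrho_x)$ and $(y,\varrho_y)$ be two chip-and-rotor configurations on $G$. Then $(x,\varrho_x)\leadsto(y,\varrho_y)$ if and only if $(y,\varrho_y)$ is reachable from $(x,\varrho_x)$ in the unconstrained sense and, for the routing reduced vector $r$ with $\pi_r(x,\varrho_x)=(y,\varrho_y)$, we have $$S_1=\{v\in V \mid y(v)<0 \text{ and } r(v)>0\}=\emptyset$$ and, for $T:=\{v\in V\mid y(v)=0\text{ and } r(v)>0\}$, $$S_2:=\{v\in T\mid \text{every vertex reachable from } v \text{ in } \varrho_y \text{ is contained in } T\}=\emptyset .$$
   Context: Digraphs are finite, multiple edges are allowed, loops are not. $\deg^+(v)$ is the out-degree of $v$, $d(u,v)$ is the number of edges from $u$ to $v$; a sink is a vertex of out-degree $0$. $L_G$ is the matrix with $(L_G)_{uu}=-\deg^+(u)$ and $(L_G)_{uv}=d(v,u)$ for $u\neq v$. A ribbon digraph is a digraph with a fixed cyclic ordering of the outgoing edges at each vertex; $e^+$ denotes the edge following $e$ in the cyclic order at the tail of $e$. A rotor configuration $\varrho$ assigns to each non-sink vertex $v$ an edge $\varrho(v)$ with tail $v$. Its rotor subgraph is the subgraph on $V$ with edge set $\{\varrho(v)\}$; "reachable from $v$ in $\varrho$" means reachable by a directed path (possibly of length $0$) in the rotor subgraph. A chip-and-rotor configuration is a pair $(x,\varrho)$ with $x\in\mathbb{Z}^{V}$ and $\varrho$ a rotor configuration. Routing at a non-sink $v$ replaces $\varrho(v)$ by $\varrho(v)^+$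 and $x$ by $x-\mathbf{1}_v+\mathbf{1}_{v'}$, where $v'$ is the head of $\varrho(v)^+$; routing at a sink has no effect. The routing at $v$ is legal if $x(v)>0$. A legal game is a finite sequence of configurations, each obtained from the previous one by a legal routing. $(x_1,\varrho_1)\leadsto(x_2,\varrho_2)$ means that there is a (possibly empty) legal game from $(x_1,\varrho_1)$ to $(x_2,\varrho_2)$. For $r\in\mathbb{Z}_{\ge0}^{V}$, $\pi_r(x,\varrho)$ is the configuration obtained from $(x,\varrho)$ by routing each vertex $v$ exactly $r(v)$ times irrespective of legality (the order does not matter). $(y,\varrho_y)$ is reachable from $(x,\varrho_x)$ in the unconstrained sense if $\pi_r(x,\varrho_x)=(y,\varrho_y)$ for some $r\in\mathbb{Z}_{\ge0}^{V}$. A period vector is $p\in\mathbb{Z}_{\ge0}^{V}$ with $L_Gp=0$. A routing period vector is a vector of the form $v\mapsto p(v)\deg^+(v)$ with $p$ a period vector. A vector $r\in\mathbb{Z}_{\ge0}^{V}$ is routing reduced if $r(v)=0$ for every sink $v$ and $r$ is not coordinatewise greater than or equal to any nonzero routing period vector. When $(y,\varrho_y)$ is reachable from $(x,\varrho_x)$ in the unconstrained sense, there is exactly one routing reduced $r$ with $\pi_r(x,\varrho_x)=(y,\varrho_y)$. -}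

module Defs where

open import Algebra.Properties.CommutativeMonoid.Sum using (sum)
open import Data.Bool.Base using (if_then_else_)
open import Data.Fin.Base using (Fin)
open import Data.Fin.Properties using (_≟_)
open import Data.Integer.Base as ℤ using (ℤ; +_; 0ℤ; 1ℤ)
open import Data.Integer.Properties using (+-0-commutativeMonoid)
open import Data.List.Base using (foldl; allFin; filter; length)
open import Data.Nat.Base as ℕ using (ℕ)
open import Data.Nat.GeneralisedArithmetic using (iterate)
import Data.Nat.Properties as ℕ
open import Data.Product.Base using (_×_; _,_; ∃-syntax; Σ-syntax)
open import Level using (0ℓ)
open import Relation.Binary.Construct.Closure.ReflexiveTransitive using (Star)
open import Relation.Binary.PropositionalEquality using (_≡_; _≢_; trans)
open import Relation.Nullary using (¬_; Dec; yes; no; does)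
open import Relation.Nullary.Decidable using (_×-dec_)
open import Relation.Unary using (Pred; _∈_)

record Digraph : Set where
  field
    #V #E     : ℕ
    tail head : Fin #E → Fin #V
    loopless  : ∀ e → tail e ≢ head e

  V E : Set
  V = Fin #V
  E = Fin #E

  deg⁺ : V → ℕ
  deg⁺ v = length (filter (λ e → tail e ≟ v) (allFin #E))

  d : V → V → ℕ
  d u v = length (filter (λ e → (tail e ≟ u) ×-dec (head e ≟ v)) (allFin #E))

  Sink NonSink : Pred V 0ℓ
  Sink v    = deg⁺ v ≡ 0
  NonSink v = ¬ Sink v

  sink? : ∀ v → Dec (Sink v)
  sink? v = deg⁺ v ℕ.≟ 0

  L : V → V → ℤ
  L u v = if does (u ≟ v) then ℤ.- (+ deg⁺ u) else + d v u

  PeriodVector : Pred (V → ℕ) 0ℓ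
  PeriodVector p = ∀ u → sum +-0-commutativeMonoid (λ v → L u v ℤ.* + p v) ≡ 0ℤ

  RoutingPeriodVector : Pred (V → ℕ) 0ℓ
  RoutingPeriodVector q = ∃[ p ] PeriodVector p × (∀ v → q v ≡ p v ℕ.* deg⁺ v)

  RoutingReduced : Pred (V → ℕ) 0ℓ
  RoutingReduced r =
    (∀ v → Sink v → r v ≡ 0) ×
    (∀ q → RoutingPeriodVector q → ¬ (∀ v → q v ≡ 0) → ¬ (∀ v → q v ℕ.≤ r v))

-- `next e` is the edge e⁺. The two laws say that `next` maps the outgoing
-- edges of each vertex to themselves and that each edge reaches all the others
-- with the same tail. Applied to `next e` and `e`, `next-cyclic` shows that
-- every edge lies on a cycle of `next`. So `next` restricts to a single cyclic
-- permutation of the outgoing edges of each non-sink.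
record RibbonDigraph : Set where
  field
    digraph : Digraph
  open Digraph digraph public
  field
    next        : E → E
    tail-next   : ∀ e → tail (next e) ≡ tail e
    next-cyclic : ∀ e f → tail e ≡ tail f → ∃[ k ] iterate next e k ≡ f

module _ (G : RibbonDigraph) where
  open RibbonDigraph G

  -- The proof that v is not a sink is irrelevant, so ϱ(v) depends on v only.
  record RotorConfig : Set where
    field
      rotor      : ∀ v → .(NonSink v) → E
      tail-rotor : ∀ v .(ns : NonSink v) → tail (rotor v ns) ≡ v

  record Config : Set where
    constructor _,_
    field
      chips  : V → ℤ
      rotors : RotorConfig

module _ {G : RibbonDigraph} where
  open RibbonDigraph G
  open RotorConfig
  open Config

  -- Equality of configurations is pointwise, as there is no function
  -- extensionality.
  infix 4 _≈_
  _≈_ : Config G → Config G → Set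
  c ≈ c′ =
    (∀ v → chips c v ≡ chips c′ v) ×
    (∀ v .(ns : NonSink v) → rotor (rotors c) v ns ≡ rotor (rotors c′) v ns)

  RotorStep : RotorConfig G → V → V → Set
  RotorStep ϱ u w = Σ[ ns ∈ NonSink u ] head (rotor ϱ u ns) ≡ w

  ReachableIn : RotorConfig G → V → V → Set
  ReachableIn ϱ = Star (RotorStep ϱ)

  𝟏 : V → V → ℤ
  𝟏 v u = if does (u ≟ v) then 1ℤ else 0ℤ

  advance : V → RotorConfig G → RotorConfig G
  rotor (advance v ϱ) u ns =
    if does (u ≟ v) then next (rotor ϱ u ns) else rotor ϱ u ns
  tail-rotor (advance v ϱ) u ns with u ≟ v
  ... | yes _ = trans (tail-next (rotor ϱ u ns)) (tail-rotor ϱ u ns)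
  ... | no  _ = tail-rotor ϱ u ns

  route : V → Config G → Config G
  route v (x , ϱ) with sink? v
  ... | yes _  = x , ϱ
  ... | no  ns =
    (λ u → x u ℤ.- 𝟏 v u ℤ.+ 𝟏 (head (next (rotor ϱ v ns))) u) , advance v ϱ

  Legal : V → Config G → Set
  Legal v c = 0ℤ ℤ.< chips c v

  infix 4 _⇝_
  data _⇝_ : Config G → Config G → Set where
    done : ∀ {c c′} → c ≈ c′ → c ⇝ c′
    step : ∀ {c c′} v → Legal v c → route v c ⇝ c′ → c ⇝ c′

  -- The vertices are taken in increasing order, each one being routed r(v)
  -- times in a row; any other order yields the same configuration up to _≈_.
  π : (V → ℕ) → Config G → Config G
  π r c = foldl (λ c′ v → iterate (route v) c′ (r v)) c (allFin #V)

  UnconstrainedReachable : Config G → Config G → Set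
  UnconstrainedReachable c c′ = ∃[ r ] π r c ≈ c′

  S₁ T : (r : V → ℕ) → Config G → Pred V 0ℓ
  S₁ r (y , _) v = y v ℤ.< 0ℤ × 0 ℕ.< r v
  T  r (y , _) v = y v ≡ 0ℤ × 0 ℕ.< r v

  S₂ : (r : V → ℕ) → Config G → Pred V 0ℓ
  S₂ r c v = v ∈ T r c × (∀ w → ReachableIn (rotors c) v w → w ∈ T r c)

module Submission where

-- Suppose r(v) routings remain to be made at each v, r vanishing on sinks.
-- Route legally as long as possible.  When no vertex of the support A of r has
-- a chip, chip conservation and S₁ = ∅ force y = 0 on A and that no chip leaves
-- A; so the last edges used, which are the rotors of ϱ_y on A, stay in A, and
-- any vertex of A lies in S₂.  Hence A = ∅ and the play is complete.
--
-- Conversely, in a legal game with routing counts s no routed vertex ends in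
-- debt, and a rotor-closed set of routed vertices contains the chip sent by
-- the last routing inside it; so S₁ and S₂ are empty for s.  The reduced r
-- satisfies r ≤ s: otherwise r − min(r,s) and s − min(r,s) have the same effect
-- and disjoint supports, so neither has any effect, making r − min(r,s) a
-- routing period vector below r.

open import Defs
open import Algebra.Bundles using (module AbelianGroup)
import Algebra.Properties.CommutativeMonoid.Sum as CommutativeMonoidSum
import Algebra.Properties.Group as GroupProperties
open import Data.Bool.Base using (true; false; if_then_else_)
open import Data.Empty using (⊥-elim-irr)
open import Data.Fin.Base using (Fin; zero; suc; finToFun; fromℕ<; funToFin; toℕ)
open import Data.Fin.Properties using (_≟_; all?; any?; ¬∀⟶∃¬; finToFun-funToFin; toℕ-fromℕ<)
open import Data.Integer.Base as ℤ using (ℤ; 0ℤ) renaming (+_ to pos)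
import Data.Integer.Properties as ℤ
open import Data.Integer.Tactic.RingSolver using (solve-∀)
open import Data.List.Base using (List; []; _∷_; _++_; allFin; applyUpTo; filter; foldl; length; map; tabulate)
open import Data.List.Membership.Propositional using (_∈_; lose)
open import Data.List.Membership.Propositional.Properties using (∈-allFin; ∈-applyUpTo⁺; ∈-applyUpTo⁻; ∈-filter⁺; ∈-filter⁻)
open import Data.List.Membership.Propositional.Properties.WithK using (unique∧set⇒bag)
open import Data.List.Properties using (filter-++; filter-some; length-++; length-applyUpTo; length-filter; map-tabulate)
open import Data.List.Relation.Binary.BagAndSetEquality using (∼bag⇒↭)
open import Data.List.Relation.Binary.Permutation.Propositional using (_↭_)
open import Data.List.Relation.Binary.Permutation.Propositional.Properties using (filter-↭; ↭-length)
open import Data.List.Relation.Unary.Unique.Propositional using (Unique)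
import Data.List.Relation.Unary.Unique.Propositional.Properties as Unique
open import Data.Nat.Base
open import Data.Nat.DivMod using (_/_; _%_; m≡m%n+[m/n]*n; m%n<n)
open import Data.Nat.GeneralisedArithmetic using (iterate)
open import Data.Nat.Induction using (<-rec)
open import Data.Nat.ListAction using () renaming (sum to sumᴸ)
open import Data.Nat.Properties as ℕ hiding (_≟_)
open import Data.Product.Base using (_×_; _,_; proj₁; proj₂; ∃-syntax)
open import Data.Sum.Base using (_⊎_; inj₁; inj₂)
open import Function.Base using (_∘_; id)
open import Function.Bundles using (_⇔_; mk⇔)
open import Level using (0ℓ)
open import Relation.Binary.Construct.Closure.ReflexiveTransitive using (ε; _◅_; _◅◅_)
open import Relation.Binary.PropositionalEquality
open import Relation.Nullary using (¬_; Dec; yes; no; does; contradiction)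
open import Relation.Nullary.Decidable using (_×-dec_; dec-false; dec-true; map′)
open import Relation.Unary using (Pred; Decidable; Empty)

module Σℕ = CommutativeMonoidSum +-0-commutativeMonoid
module Σℤ = CommutativeMonoidSum ℤ.+-0-commutativeMonoid

open GroupProperties (AbelianGroup.group ℤ.+-0-abelianGroup) using (∙-cancelʳ)

private variable
  A : Set
  n : ℕ

-- Iterates, least witnesses and filtered lists

iterate-+ : (f : A → A) (x : A) (m n : ℕ) →
            iterate f x (m + n) ≡ iterate f (iterate f x m) n
iterate-+ f x zero    n = refl
iterate-+ f x (suc m) n = iterate-+ f (f x) m n

iterate-* : (f : A → A) (x : A) (m k : ℕ) →
            iterate f x m ≡ x → iterate f x (k * m) ≡ x
iterate-* f x m zero    eq = refl
iterate-* f x m (suc k) eq =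
  trans (iterate-+ f x m (k * m))
    (trans (cong (λ y → iterate f y (k * m)) eq) (iterate-* f x m k eq))

iterate-% : (f : A → A) (x : A) (m n : ℕ) .{{_ : NonZero m}} →
            iterate f x m ≡ x → iterate f x n ≡ iterate f x (n % m)
iterate-% f x m n eq = begin
  iterate f x n                                   ≡⟨ cong (iterate f x) n≡ ⟩
  iterate f x (n / m * m + n % m)                 ≡⟨ iterate-+ f x (n / m * m) (n % m) ⟩
  iterate f (iterate f x (n / m * m)) (n % m)     ≡⟨ cong (λ y → iterate f y (n % m)) (iterate-* f x m (n / m) eq) ⟩
  iterate f x (n % m)                             ∎
  where
  open ≡-Reasoning
  n≡ : n ≡ n / m * m + n % m
  n≡ = trans (m≡m%n+[m/n]*n n m) (+-comm (n % m) _)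

least : {P : Pred ℕ 0ℓ} → Decidable P → ∀ n → P n →
        ∃[ m ] P m × (∀ {i} → i < m → ¬ P i)
least {P} P? = <-rec _ search
  where
  search : ∀ n → (∀ {i} → i < n → P i → ∃[ m ] P m × (∀ {i} → i < m → ¬ P i)) →
           P n → ∃[ m ] P m × (∀ {i} → i < m → ¬ P i)
  search n rec pn with anyUpTo? P? n
  ... | yes (i , i<n , pi) = rec i<n pi
  ... | no ¬smaller        = n , pn , λ i<n pi → ¬smaller (_ , i<n , pi)

length-filter-filter : {P Q : Pred A 0ℓ} (P? : Decidable P) (Q? : Decidable Q) (xs : List A) →
                       length (filter Q? (filter P? xs)) ≡
                       length (filter (λ x → P? x ×-dec Q? x) xs)
length-filter-filter P? Q? [] = refl
length-filter-filter P? Q? (x ∷ xs) with does (P? x)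
... | false = length-filter-filter P? Q? xs
... | true with does (Q? x)
...   | false = length-filter-filter P? Q? xs
...   | true  = cong suc (length-filter-filter P? Q? xs)

-- Orbits of the cyclic edge order

module Orbits (G : RibbonDigraph) where
  open RibbonDigraph G

  tail-iterate : ∀ e n → tail (iterate next e n) ≡ tail e
  tail-iterate e zero    = refl
  tail-iterate e (suc n) = trans (tail-iterate (next e) n) (tail-next e)

  -- Routing n times at a vertex whose rotor is e sends chips along these edges.
  trail : E → ℕ → List E
  trail e n = applyUpTo (λ i → iterate next e (suc i)) n

  visits : E → ℕ → V → ℕ
  visits e n u = length (filter (λ f → head f ≟ u) (trail e n))

  trail-+ : ∀ e m n → trail e (m + n) ≡ trail e m ++ trail (iterate next e m) n
  trail-+ e zero    n = refl
  trail-+ e (suc m) n = cong (next e ∷_) (trail-+ (next e) m n)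

  visits-+ : ∀ e m n u → visits e (m + n) u ≡ visits e m u + visits (iterate next e m) n u
  visits-+ e m n u = begin
    length (filter _ (trail e (m + n)))
      ≡⟨ cong (length ∘ filter _) (trail-+ e m n) ⟩
    length (filter _ (trail e m ++ trail (iterate next e m) n))
      ≡⟨ cong length (filter-++ (λ f → head f ≟ u) (trail e m) _) ⟩
    length (filter _ (trail e m) ++ filter _ (trail (iterate next e m) n))
      ≡⟨ length-++ (filter (λ f → head f ≟ u) (trail e m)) ⟩
    visits e m u + visits (iterate next e m) n u ∎
    where open ≡-Reasoning

  -- Some power of `next` leads from `iterate next e i` back to `e`; applying that power to both
  -- sides of the equation cancels the first `i` steps.
  next-cancel : ∀ e i n → iterate next e i ≡ iterate next e (i + n) →
                iterate next e n ≡ e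
  next-cancel e i n eq with next-cyclic (iterate next e i) e (tail-iterate e i)
  ... | k , back = begin
    iterate next e n                                      ≡⟨ cong (λ f → iterate next f n) back ⟨
    iterate next (iterate next (iterate next e i) k) n    ≡⟨ iterate-+ next _ k n ⟨
    iterate next (iterate next e i) (k + n)               ≡⟨ cong (iterate next (iterate next e i)) (+-comm k n) ⟩
    iterate next (iterate next e i) (n + k)               ≡⟨ iterate-+ next _ n k ⟩
    iterate next (iterate next (iterate next e i) n) k    ≡⟨ cong (λ f → iterate next f k) (iterate-+ next e i n) ⟨
    iterate next (iterate next e (i + n)) k               ≡⟨ cong (λ f → iterate next f k) eq ⟨
    iterate next (iterate next e i) k                     ≡⟨ back ⟩
    e                                                     ∎
    where open ≡-Reasoning

  outEdges : V → List E
  outEdges v = filter (λ e → tail e ≟ v) (allFin #E)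

  least-period : ∀ e → ∃[ m ] (iterate next e (suc m) ≡ e) ×
                       (∀ {i} → i < m → iterate next e (suc i) ≢ e)
  -- Starting from `next e` instead of `e` makes the period found, `suc k`, positive.
  least-period e with next-cyclic (next e) e (tail-next e)
  ... | k , back = least (λ i → iterate next e (suc i) ≟ e) k back

  -- Two lists without repetitions and with the same members are permutations of each other.
  -- Minimality of the period excludes repetitions in the trail, and cyclicity makes it exhaust the
  -- out-edges.
  least-period-trail : ∀ e m → iterate next e (suc m) ≡ e →
                       (∀ {i} → i < m → iterate next e (suc i) ≢ e) →
                       trail e (suc m) ↭ outEdges (tail e)
  least-period-trail e m period minimal =
    ∼bag⇒↭ (unique∧set⇒bag unique (Unique.filter⁺ _ (Unique.allFin⁺ #E)) (mk⇔ to from))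
    where
    f : ℕ → E
    f i = iterate next e (suc i)

    unique : Unique (trail e (suc m))
    unique = Unique.applyUpTo⁺₁ f (suc m) λ {i} {j} i<j j<m eq →
      let n , j≡ = m≤n⇒∃[o]m+o≡n i<j in
      -- With `j = suc i + n`, a repetition at `i` and `j` would give the period `suc n`, which is
      -- too short.
      minimal
        (≤-trans (s≤s (m≤n+m n i)) (≤-trans (≤-reflexive j≡) (≤-pred j<m)))
        (next-cancel e (suc i) (suc n)
          (trans eq (cong (iterate next e) (trans (cong suc (sym j≡)) (cong suc (sym (+-suc i n)))))))

    to : ∀ {x} → x ∈ trail e (suc m) → x ∈ outEdges (tail e)
    to x∈ with ∈-applyUpTo⁻ f x∈
    ... | i , _ , refl = ∈-filter⁺ _ (∈-allFin _) (tail-iterate e (suc i))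

    -- The trail consists of iterates of `next e`, so exponents are reduced modulo the period from
    -- that edge.
    period′ : iterate next (next e) (suc m) ≡ next e
    period′ = next-cancel (next e) m (suc m) (begin
      iterate next (next e) m             ≡⟨ period ⟩
      e                                   ≡⟨ period ⟨
      iterate next e (suc m)              ≡⟨ cong (λ g → iterate next g (suc m)) period ⟨
      iterate next (iterate next (next e) m) (suc m) ≡⟨ iterate-+ next (next e) m (suc m) ⟨
      iterate next (next e) (m + suc m)   ∎)
      where open ≡-Reasoning

    from : ∀ {x} → x ∈ outEdges (tail e) → x ∈ trail e (suc m)
    from {x} x∈ with next-cyclic (next e) x (trans (tail-next e) (sym (proj₂ (∈-filter⁻ (λ e′ → tail e′ ≟ tail e) {xs = allFin #E} x∈))))
    ... | k , refl =
      subst (_∈ trail e (suc m)) (sym (iterate-% next (next e) (suc m) k period′))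
        (∈-applyUpTo⁺ f (m%n<n k (suc m)))

  -- Comparing the lengths of the trail over one least period and of the list of out-edges
  -- identifies the period with the out-degree.
  deg-least-period : ∀ e → ∃[ m ] suc m ≡ deg⁺ (tail e) × iterate next e (suc m) ≡ e ×
                     (∀ {i} → i < m → iterate next e (suc i) ≢ e) ×
                     trail e (suc m) ↭ outEdges (tail e)
  deg-least-period e with least-period e
  ... | m , period , minimal =
    let p = least-period-trail e m period minimal in
    m , trans (sym (length-applyUpTo (λ i → iterate next e (suc i)) (suc m))) (↭-length p) ,
    period , minimal , p

  trail-deg : ∀ e → trail e (deg⁺ (tail e)) ↭ outEdges (tail e)
  trail-deg e with deg-least-period e
  ... | m , m≡deg , _ , _ , p = subst (λ n → trail e n ↭ outEdges (tail e)) m≡deg p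

  iterate-deg : ∀ e → iterate next e (deg⁺ (tail e)) ≡ e
  iterate-deg e with deg-least-period e
  ... | m , m≡deg , period , _ = subst (λ n → iterate next e n ≡ e) m≡deg period

  -- A nonzero remainder modulo the least period would be a smaller positive period.
  period⇒deg∣ : ∀ e n → iterate next e n ≡ e → ∃[ k ] n ≡ k * deg⁺ (tail e)
  period⇒deg∣ e n eq with deg-least-period e
  ... | m , m≡deg , period , minimal , _ =
    n / suc m , subst (λ l → n ≡ n / suc m * l) m≡deg n≡
    where
    n≡ : n ≡ n / suc m * suc m
    n≡ with n % suc m | m≡m%n+[m/n]*n n (suc m) | m%n<n n (suc m) | iterate-% next e (suc m) n period
    ... | zero  | split | _   | _    = split
    ... | suc j | _     | j<m | same = contradiction (trans (sym same) eq) (minimal (≤-pred j<m))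

  visits-deg : ∀ e u → visits e (deg⁺ (tail e)) u ≡ d (tail e) u
  visits-deg e u = trans (↭-length (filter-↭ (λ f → head f ≟ u) (trail-deg e)))
    (length-filter-filter (λ f → tail f ≟ tail e) (λ f → head f ≟ u) (allFin #E))

  visits-*deg : ∀ e k u → visits e (k * deg⁺ (tail e)) u ≡ k * d (tail e) u
  visits-*deg e zero    u = refl
  visits-*deg e (suc k) u =
    trans (visits-+ e (deg⁺ (tail e)) (k * deg⁺ (tail e)) u)
      (cong₂ _+_ (visits-deg e u)
        (trans (cong (λ f → visits f (k * deg⁺ (tail e)) u) (iterate-deg e))
          (visits-*deg e k u)))

-- Finite sums of natural numbers

sum-zero : {f : Fin n → ℕ} → (∀ i → f i ≡ 0) → Σℕ.sum f ≡ 0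
sum-zero {n} f≡0 = trans (Σℕ.sum-cong-≗ f≡0) (Σℕ.sum-replicate-zero n)

sum-single : (f : Fin n → ℕ) (i : Fin n) → (∀ j → j ≢ i → f j ≡ 0) → Σℕ.sum f ≡ f i
sum-single f zero    off =
  trans (cong (f zero +_) (sum-zero (λ j → off (suc j) λ ()))) (+-identityʳ (f zero))
sum-single f (suc i) off =
  cong₂ _+_ (off zero λ ()) (sum-single (f ∘ suc) i (λ j j≢i → off (suc j) (λ { refl → j≢i refl })))

sum-mono-≤ : {f g : Fin n → ℕ} → (∀ i → f i ≤ g i) → Σℕ.sum f ≤ Σℕ.sum g
sum-mono-≤ {zero}  f≤g = z≤n
sum-mono-≤ {suc n} f≤g = +-mono-≤ (f≤g zero) (sum-mono-≤ (f≤g ∘ suc))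

sum-mono-< : {f g : Fin n → ℕ} → (∀ i → f i ≤ g i) → ∀ i → f i < g i → Σℕ.sum f < Σℕ.sum g
sum-mono-< f≤g zero    f<g = +-mono-<-≤ f<g (sum-mono-≤ (f≤g ∘ suc))
sum-mono-< f≤g (suc i) f<g = +-mono-≤-< (f≤g zero) (sum-mono-< (f≤g ∘ suc) i f<g)

-- This turns conservation of the total number of chips into equalities at each vertex.
sum-≤-antisym : {f g : Fin n → ℕ} → (∀ i → f i ≤ g i) → Σℕ.sum f ≡ Σℕ.sum g → ∀ i → f i ≡ g i
sum-≤-antisym f≤g eq i =
  ≤-antisym (f≤g i) (≮⇒≥ λ f<g → <⇒≢ (sum-mono-< f≤g i f<g) eq)

0<sum : (f : Fin n → ℕ) (i : Fin n) → 0 < f i → 0 < Σℕ.sum f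
0<sum {n} f i 0<f = subst (_< Σℕ.sum f) (sum-zero {n} {λ _ → 0} λ _ → refl)
  (sum-mono-< {f = λ _ → 0} (λ _ → z≤n) i 0<f)

sum-tabulate : (f : Fin n → ℕ) → sumᴸ (tabulate f) ≡ Σℕ.sum f
sum-tabulate {zero}  f = refl
sum-tabulate {suc n} f = cong (f zero +_) (sum-tabulate (f ∘ suc))

single : Fin n → ℕ → Fin n → ℕ
single i k j = if does (j ≟ i) then k else 0

single-eq : (i : Fin n) (k : ℕ) → single i k i ≡ k
single-eq i k rewrite dec-true (i ≟ i) refl = refl

single-≢ : (i : Fin n) {j : Fin n} (k : ℕ) → j ≢ i → single i k j ≡ 0
single-≢ i {j} k j≢i rewrite dec-false (j ≟ i) j≢i = refl

single-0 : (i j : Fin n) → single i 0 j ≡ 0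
single-0 i j with does (j ≟ i)
... | true  = refl
... | false = refl

single-+ : (i : Fin n) (k l : ℕ) (j : Fin n) → single i (k + l) j ≡ single i k j + single i l j
single-+ i k l j with does (j ≟ i)
... | true  = refl
... | false = refl

sum-fibres : (f : A → Fin n) (xs : List A) →
             Σℕ.sum (λ i → length (filter (λ x → f x ≟ i) xs)) ≡ length xs
sum-fibres {n = n} f []       = Σℕ.sum-replicate-zero n
sum-fibres f (x ∷ xs) = begin
  Σℕ.sum (λ i → length (filter (λ y → f y ≟ i) (x ∷ xs)))
    ≡⟨ Σℕ.sum-cong-≗ split ⟩
  Σℕ.sum (λ i → single (f x) 1 i + fibre i)
    ≡⟨ Σℕ.∑-distrib-+ (single (f x) 1) fibre ⟩
  Σℕ.sum (single (f x) 1) + Σℕ.sum fibre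
    ≡⟨ cong₂ _+_ (trans (sum-single _ (f x) λ j → single-≢ (f x) 1) (single-eq (f x) 1)) (sum-fibres f xs) ⟩
  suc (length xs) ∎
  where
  open ≡-Reasoning
  fibre : _ → ℕ
  fibre i = length (filter (λ y → f y ≟ i) xs)
  split : ∀ i → length (filter (λ y → f y ≟ i) (x ∷ xs)) ≡ single (f x) 1 i + fibre i
  split i with f x ≟ i
  ... | yes refl rewrite dec-true (f x ≟ f x) refl = refl
  ... | no  fx≢i rewrite dec-false (i ≟ f x) (fx≢i ∘ sym) = refl

-- Closed form of unconstrained routing

module Routing (G : RibbonDigraph) where
  open RibbonDigraph G
  open Orbits G
  open RotorConfig
  open Config

  sent : RotorConfig G → V → ℕ → V → ℕ
  sent ϱ v n u with sink? v
  ... | yes _  = 0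
  ... | no  ns = visits (rotor ϱ v ns) n u

  sent-nonSink : ∀ ϱ v (ns : NonSink v) n u → sent ϱ v n u ≡ visits (rotor ϱ v ns) n u
  sent-nonSink ϱ v ns n u with sink? v
  ... | yes s = contradiction s ns
  ... | no  _ = refl

  sent-0 : ∀ ϱ v u → sent ϱ v 0 u ≡ 0
  sent-0 ϱ v u with sink? v
  ... | yes _ = refl
  ... | no  _ = refl

  sum-sent : ∀ ϱ v n → (Sink v → n ≡ 0) → Σℕ.sum (sent ϱ v n) ≡ n
  sum-sent ϱ v n idle with sink? v
  ... | yes s = trans (Σℕ.sum-replicate-zero #V) (sym (idle s))
  ... | no ns = trans (sum-fibres head (trail (rotor ϱ v ns) n)) (length-applyUpTo _ n)

  inflow : RotorConfig G → (V → ℕ) → V → ℕ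
  inflow ϱ r u = Σℕ.sum (λ v → sent ϱ v (r v) u)

  -- Chip conservation: after exchanging the two sums, each routing at a non-sink delivers exactly
  -- one chip.
  sum-inflow : ∀ ϱ r → (∀ v → Sink v → r v ≡ 0) → Σℕ.sum (inflow ϱ r) ≡ Σℕ.sum r
  sum-inflow ϱ r idle =
    trans (Σℕ.∑-comm (λ u v → sent ϱ v (r v) u)) (Σℕ.sum-cong-≗ (λ v → sum-sent ϱ v (r v) (idle v)))

  -- The closed form of π r c ≈ c′, for r vanishing on the sinks.
  record Reaches (r : V → ℕ) (c c′ : Config G) : Set where
    field
      sink-idle : ∀ v → Sink v → r v ≡ 0
      chips-eq  : ∀ u → chips c′ u ≡ chips c u ℤ.- pos (r u) ℤ.+ pos (inflow (rotors c) r u)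
      rotor-eq  : ∀ v .(ns : NonSink v) →
                  rotor (rotors c′) v ns ≡ iterate next (rotor (rotors c) v ns) (r v)
  open Reaches public

  private variable
    r s      : V → ℕ
    c c₁ c₂ : Config G

  reaches-cong : (∀ v → r v ≡ s v) → Reaches r c c₁ → Reaches s c c₁
  reaches-cong {r} {s} {c} r≡s R = record
    { sink-idle = λ v sv → trans (sym (r≡s v)) (sink-idle R v sv)
    ; chips-eq  = λ u → trans (chips-eq R u)
        (cong₂ (λ k l → chips c u ℤ.- pos k ℤ.+ pos l) (r≡s u)
          (Σℕ.sum-cong-≗ (λ v → cong (λ k → sent (rotors c) v k u) (r≡s v))))
    ; rotor-eq  = λ v ns →
        trans (rotor-eq R v ns) (cong (iterate next (rotor (rotors c) v ns)) (r≡s v))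
    }

  reaches-resp-≈ : c₁ ≈ c₂ → Reaches r c c₁ → Reaches r c c₂
  reaches-resp-≈ (chips≡ , rotor≡) R = record
    { sink-idle = sink-idle R
    ; chips-eq  = λ u → trans (sym (chips≡ u)) (chips-eq R u)
    ; rotor-eq  = λ v ns → trans (sym (rotor≡ v ns)) (rotor-eq R v ns)
    }

  reaches-deterministic : Reaches r c c₁ → Reaches r c c₂ → c₁ ≈ c₂
  reaches-deterministic R S =
    (λ v → trans (chips-eq R v) (sym (chips-eq S v))) ,
    (λ v ns → trans (rotor-eq R v ns) (sym (rotor-eq S v ns)))

  reaches-0 : Reaches (λ _ → 0) c c
  reaches-0 {c} = record
    { sink-idle = λ _ _ → refl
    ; chips-eq  = λ u → sym (trans
        (cong (λ k → chips c u ℤ.- 0ℤ ℤ.+ pos k) (sum-zero (λ v → sent-0 (rotors c) v u)))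
        (trans (ℤ.+-identityʳ _) (ℤ.+-identityʳ _)))
    ; rotor-eq  = λ _ _ → refl
    }

  -- The second batch of routings continues each trail at the rotor where the first batch left it.
  inflow-+ : Reaches r c c₁ → ∀ s u →
             inflow (rotors c) (λ v → r v + s v) u ≡ inflow (rotors c) r u + inflow (rotors c₁) s u
  inflow-+ {r} {c} {c₁} R s u =
    trans (Σℕ.sum-cong-≗ sent-+) (Σℕ.∑-distrib-+ _ (λ v → sent (rotors c₁) v (s v) u))
    where
    sent-+ : ∀ v → sent (rotors c) v (r v + s v) u ≡
                   sent (rotors c) v (r v) u + sent (rotors c₁) v (s v) u
    sent-+ v with sink? v
    ... | yes _ = refl
    ... | no ns = trans (visits-+ (rotor (rotors c) v ns) (r v) (s v) u)
      (cong (λ e → visits (rotor (rotors c) v ns) (r v) u + visits e (s v) u)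
        (sym (rotor-eq R v ns)))

  private
    shift-+ : ∀ x a b i j → x ℤ.- a ℤ.+ i ℤ.- b ℤ.+ j ≡ x ℤ.- (a ℤ.+ b) ℤ.+ (i ℤ.+ j)
    shift-+ = solve-∀

  chips-+ : Reaches r c c₁ → ∀ s u →
            chips c₁ u ℤ.- pos (s u) ℤ.+ pos (inflow (rotors c₁) s u) ≡
            chips c u ℤ.- pos (r u + s u) ℤ.+ pos (inflow (rotors c) (λ v → r v + s v) u)
  chips-+ {r} {c} {c₁} R s u = begin
    chips c₁ u ℤ.- pos (s u) ℤ.+ pos (inflow (rotors c₁) s u)
      ≡⟨ cong (λ x → x ℤ.- pos (s u) ℤ.+ pos (inflow (rotors c₁) s u)) (chips-eq R u) ⟩
    chips c u ℤ.- pos (r u) ℤ.+ pos (inflow (rotors c) r u) ℤ.- pos (s u) ℤ.+ pos (inflow (rotors c₁) s u)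
      ≡⟨ shift-+ (chips c u) (pos (r u)) (pos (s u)) _ _ ⟩
    chips c u ℤ.- (pos (r u) ℤ.+ pos (s u)) ℤ.+ (pos (inflow (rotors c) r u) ℤ.+ pos (inflow (rotors c₁) s u))
      ≡⟨ cong₂ (λ k l → chips c u ℤ.- k ℤ.+ l) (sym (ℤ.pos-+ (r u) (s u)))
           (trans (sym (ℤ.pos-+ _ (inflow (rotors c₁) s u))) (cong pos (sym (inflow-+ R s u)))) ⟩
    chips c u ℤ.- pos (r u + s u) ℤ.+ pos (inflow (rotors c) (λ v → r v + s v) u) ∎
    where open ≡-Reasoning

  reaches-+ : Reaches r c c₁ → Reaches s c₁ c₂ → Reaches (λ v → r v + s v) c c₂
  reaches-+ {r} {c} {c₁} {s} {c₂} R S = record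
    { sink-idle = λ v sv → cong₂ _+_ (sink-idle R v sv) (sink-idle S v sv)
    ; chips-eq  = λ u → trans (chips-eq S u) (chips-+ R s u)
    ; rotor-eq  = λ v ns → trans (rotor-eq S v ns)
        (trans (cong (λ e → iterate next e (s v)) (rotor-eq R v ns))
          (sym (iterate-+ next (rotor (rotors c) v ns) (r v) (s v))))
    }

  -- The effect of a batch depends only on its counts, so any part of a vector may be routed first
  -- and the rest afterwards.
  reaches-cancel : Reaches r c c₁ → Reaches (λ v → r v + s v) c c₂ → Reaches s c₁ c₂
  reaches-cancel {r} {c} {c₁} {s} {c₂} R RS = record
    { sink-idle = λ v sv → m+n≡0⇒n≡0 (r v) (sink-idle RS v sv)
    ; chips-eq  = λ u → trans (chips-eq RS u) (sym (chips-+ R s u))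
    ; rotor-eq  = λ v ns → trans (rotor-eq RS v ns)
        (trans (iterate-+ next (rotor (rotors c) v ns) (r v) (s v))
          (cong (λ e → iterate next e (s v)) (sym (rotor-eq R v ns))))
    }

  -- Agreement of `π` with the closed form

  route-sink : ∀ v (c : Config G) → Sink v → route v c ≡ c
  route-sink v c sv with sink? v
  ... | yes _  = refl
  ... | no  ns = contradiction sv ns

  single-idle : ∀ v → NonSink v → ∀ k w → Sink w → single v k w ≡ 0
  single-idle v ns k w sw = single-≢ v k (λ w≡v → ns (subst Sink w≡v sw))

  inflow-single : ∀ ϱ v k u → inflow ϱ (single v k) u ≡ sent ϱ v k u
  inflow-single ϱ v k u = trans
    (sum-single (λ w → sent ϱ w (single v k w) u) v
      (λ w w≢v → trans (cong (λ l → sent ϱ w l u) (single-≢ v k w≢v)) (sent-0 ϱ w u)))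
    (cong (λ l → sent ϱ v l u) (single-eq v k))

  visits-1 : ∀ e u → pos (visits e 1 u) ≡ 𝟏 {G} (head (next e)) u
  visits-1 e u with head (next e) ≟ u
  ... | yes refl rewrite dec-true (u ≟ u) refl = refl
  ... | no  ≢u   rewrite dec-false (u ≟ head (next e)) (≢u ∘ sym) = refl

  pos-single : ∀ v u → pos (single v 1 u) ≡ 𝟏 {G} v u
  pos-single v u with does (u ≟ v)
  ... | true  = refl
  ... | false = refl

  route-reaches : ∀ v c → NonSink v → Reaches (single v 1) c (route v c)
  route-reaches v c ns with sink? v
  ... | yes sv = contradiction sv ns
  ... | no  _  = record
    { sink-idle = single-idle v ns 1
    ; chips-eq  = λ u → cong₂ (λ k l → chips c u ℤ.- k ℤ.+ l) (sym (pos-single v u))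
        (sym (trans (cong pos (trans (inflow-single (rotors c) v 1 u) (sent-nonSink (rotors c) v ns 1 u)))
          (visits-1 (rotor (rotors c) v ns) u)))
    ; rotor-eq  = rotor-advance
    }
    where
    rotor-advance : ∀ u .(ns : NonSink u) → rotor (advance v (rotors c)) u ns ≡
                    iterate next (rotor (rotors c) u ns) (single v 1 u)
    rotor-advance u ns with does (u ≟ v)
    ... | true  = refl
    ... | false = refl

  iterate-route-sink : ∀ v (c : Config G) k → Sink v → iterate (route v) c k ≡ c
  iterate-route-sink v c zero    sv = refl
  iterate-route-sink v c (suc k) sv =
    trans (cong (λ c → iterate (route v) c k) (route-sink v c sv)) (iterate-route-sink v c k sv)

  iterate-route-nonSink : ∀ v c k → NonSink v → Reaches (single v k) c (iterate (route v) c k)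
  iterate-route-nonSink v c zero    ns = reaches-cong (sym ∘ single-0 v) reaches-0
  iterate-route-nonSink v c (suc k) ns =
    reaches-cong (λ u → sym (single-+ v 1 k u))
      (reaches-+ (route-reaches v c ns) (iterate-route-nonSink v (route v c) k ns))

  -- `π` ignores the values of a vector at sinks, whereas `Reaches` demands that they vanish.
  clip : (V → ℕ) → V → ℕ
  clip r v with sink? v
  ... | yes _ = 0
  ... | no  _ = r v

  clip-id : (∀ v → Sink v → r v ≡ 0) → ∀ v → clip r v ≡ r v
  clip-id idle v with sink? v
  ... | yes sv = sym (idle v sv)
  ... | no  _  = refl

  iterate-route : ∀ r v c → Reaches (single v (clip r v)) c (iterate (route v) c (r v))
  iterate-route r v c with sink? v
  ... | yes sv = subst (Reaches _ c) (sym (iterate-route-sink v c (r v) sv))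
                   (reaches-cong (sym ∘ single-0 v) reaches-0)
  ... | no  ns = iterate-route-nonSink v c (r v) ns

  foldl-route : ∀ r vs c → Reaches (λ u → sumᴸ (map (λ v → single v (clip r v) u) vs)) c
                             (foldl (λ c′ v → iterate (route v) c′ (r v)) c vs)
  foldl-route r []       c = reaches-0
  foldl-route r (v ∷ vs) c = reaches-+ (iterate-route r v c) (foldl-route r vs _)

  π-reaches : ∀ r c → Reaches (clip r) c (π r c)
  π-reaches r c = reaches-cong total (foldl-route r (allFin #V) c)
    where
    total : ∀ u → sumᴸ (map (λ v → single v (clip r v) u) (allFin #V)) ≡ clip r u
    total u = trans (cong sumᴸ (map-tabulate id (λ v → single v (clip r v) u)))
      (trans (sum-tabulate (λ v → single v (clip r v) u))
        (trans (sum-single (λ v → single v (clip r v) u) u (λ v v≢u → single-≢ v _ (v≢u ∘ sym)))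
          (single-eq u (clip r u))))

  π≈⇒reaches : ∀ r c c₁ → π r c ≈ c₁ → Reaches (clip r) c c₁
  π≈⇒reaches r c c₁ eq = reaches-resp-≈ eq (π-reaches r c)

  reaches⇒π≈ : Reaches r c c₁ → π r c ≈ c₁
  reaches⇒π≈ {r} {c} R =
    reaches-deterministic (reaches-cong (clip-id (sink-idle R)) (π-reaches r c)) R

-- Sums in the integers and search among bounded vectors

pos-sum : (f : Fin n → ℕ) → Σℤ.sum (pos ∘ f) ≡ pos (Σℕ.sum f)
pos-sum {zero}  f = refl
pos-sum {suc n} f = trans (cong (λ k → pos (f zero) ℤ.+ k) (pos-sum (f ∘ suc))) (sym (ℤ.pos-+ (f zero) _))

≤-sum : (f : Fin n → ℕ) (i : Fin n) → f i ≤ Σℕ.sum f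
≤-sum f i = subst (_≤ Σℕ.sum f)
  (trans (sum-single (single i (f i)) i (λ j → single-≢ i (f i))) (single-eq i (f i)))
  (sum-mono-≤ below)
  where
  below : ∀ j → single i (f i) j ≤ f j
  below j with j ≟ i
  ... | yes refl = ≤-refl
  ... | no  _    = z≤n

-- Bounded functions are coded by the elements of a finite type, which is searched exhaustively.
-- Decoding recovers a function only pointwise, hence the hypothesis that `P` respects pointwise
-- equality.
bounded-search? : (b : ℕ) {P : (Fin n → ℕ) → Set} → (∀ f → Dec (P f)) →
                  (∀ {f g} → (∀ i → f i ≡ g i) → P f → P g) →
                  (∀ {f} → P f → ∀ i → f i < b) → Dec (∃[ f ] P f)
bounded-search? b P? resp bounded =
  map′ (λ (k , pk) → _ , pk)
    (λ (f , pf) → funToFin (λ i → fromℕ< (bounded pf i)) ,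
       resp (λ i → sym (trans (cong toℕ (finToFun-funToFin (λ i → fromℕ< (bounded pf i)) i))
                              (toℕ-fromℕ< (bounded pf i)))) pf)
    (any? (λ k → P? (toℕ ∘ finToFun {b} k)))

i-j+j≡i : ∀ i j → i ℤ.- j ℤ.+ j ≡ i
i-j+j≡i = solve-∀

-- Period vectors as routings without effect

module Legality (G : RibbonDigraph) where
  open RibbonDigraph G
  open Orbits G
  open Routing G
  open RotorConfig
  open Config

  private variable
    r s         : V → ℕ
    c c₁ c₂ c′ : Config G

  d-sink : ∀ {v} u → Sink v → d v u ≡ 0
  d-sink {v} u sv = n≤0⇒n≡0 (begin
    d v u  ≡⟨ length-filter-filter (λ e → tail e ≟ v) (λ e → head e ≟ u) (allFin #E) ⟨
    length (filter (λ e → head e ≟ u) (outEdges v))  ≤⟨ length-filter (λ e → head e ≟ u) (outEdges v) ⟩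
    deg⁺ v ≡⟨ sv ⟩
    0      ∎)
    where open ≤-Reasoning

  d-self : ∀ u → d u u ≡ 0
  d-self u = none (allFin #E)
    where
    none : ∀ es → length (filter (λ e → (tail e ≟ u) ×-dec (head e ≟ u)) es) ≡ 0
    none [] = refl
    none (e ∷ es) with tail e ≟ u | head e ≟ u
    ... | no _     | _        = none es
    ... | yes _    | no _     = none es
    ... | yes refl | yes h≡t  = contradiction (sym h≡t) (loopless e)

  -- The added term vanishes off the diagonal and cancels the negative entry of `L` on it, where
  -- `d u u` is zero by the absence of loops.
  L-* : ∀ (p : V → ℕ) u v →
        L u v ℤ.* pos (p v) ℤ.+ pos (single u (p u * deg⁺ u) v) ≡ pos (p v * d v u)
  L-* p u v with u ≟ v
  ... | yes refl rewrite dec-true (u ≟ u) refl | d-self u | *-zeroʳ (p u) | ℤ.pos-* (p u) (deg⁺ u) =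
    cancel (pos (deg⁺ u)) (pos (p u))
    where
    cancel : ∀ a b → (ℤ.- a) ℤ.* b ℤ.+ b ℤ.* a ≡ 0ℤ
    cancel = solve-∀
  ... | no u≢v rewrite dec-false (v ≟ u) (u≢v ∘ sym) =
    trans (ℤ.+-identityʳ _) (trans (sym (ℤ.pos-* (d v u) (p v))) (cong pos (*-comm (d v u) (p v))))

  L-sum : ∀ (p : V → ℕ) u →
          Σℤ.sum (λ v → L u v ℤ.* pos (p v)) ℤ.+ pos (p u * deg⁺ u) ≡
          pos (Σℕ.sum (λ v → p v * d v u))
  L-sum p u = begin
    Σℤ.sum Lp ℤ.+ pos (p u * deg⁺ u)
      ≡⟨ cong (λ k → Σℤ.sum Lp ℤ.+ pos k)
           (trans (sum-single out u (λ v → single-≢ u _)) (single-eq u _)) ⟨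
    Σℤ.sum Lp ℤ.+ pos (Σℕ.sum out)         ≡⟨ cong (λ k → Σℤ.sum Lp ℤ.+ k) (pos-sum out) ⟨
    Σℤ.sum Lp ℤ.+ Σℤ.sum (pos ∘ out)       ≡⟨ Σℤ.∑-distrib-+ Lp (pos ∘ out) ⟨
    Σℤ.sum (λ v → Lp v ℤ.+ pos (out v))    ≡⟨ Σℤ.sum-cong-≗ (L-* p u) ⟩
    Σℤ.sum (λ v → pos (p v * d v u))       ≡⟨ pos-sum (λ v → p v * d v u) ⟩
    pos (Σℕ.sum (λ v → p v * d v u))       ∎
    where
    open ≡-Reasoning
    Lp : V → ℤ
    Lp v = L u v ℤ.* pos (p v)
    out : V → ℕ
    out = single u (p u * deg⁺ u)

  -- The equation for the kernel of `L`, with the diagonal moved to the other side to avoid negative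
  -- numbers.
  Balanced : (V → ℕ) → Set
  Balanced p = ∀ u → Σℕ.sum (λ v → p v * d v u) ≡ p u * deg⁺ u

  balanced⇒period : ∀ p → Balanced p → PeriodVector p
  balanced⇒period p bal u = ∙-cancelʳ (pos (p u * deg⁺ u)) _ _
    (trans (L-sum p u) (trans (cong pos (bal u)) (sym (ℤ.+-identityˡ _))))

  period⇒balanced : ∀ p → PeriodVector p → Balanced p
  period⇒balanced p per u = ℤ.+-injective
    (trans (sym (L-sum p u)) (trans (cong (ℤ._+ pos (p u * deg⁺ u)) (per u)) (ℤ.+-identityˡ _)))

  sent-*deg : ∀ ϱ v k u → sent ϱ v (k * deg⁺ v) u ≡ k * d v u
  sent-*deg ϱ v k u with sink? v
  ... | yes sv = sym (trans (cong (k *_) (d-sink u sv)) (*-zeroʳ k))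
  ... | no ns  = subst (λ w → visits (rotor ϱ v ns) (k * deg⁺ w) u ≡ k * d w u)
                   (tail-rotor ϱ v ns) (visits-*deg (rotor ϱ v ns) k u)

  -- Making `p v` full turns at each `v` restores every rotor, and by balance each vertex receives
  -- as many chips as it sends.
  period⇒reaches-self : RoutingPeriodVector r → ∀ c → Reaches r c c
  period⇒reaches-self {r} (p , per , r≡) c = reaches-cong (sym ∘ r≡) record
    { sink-idle = λ v sv → trans (cong (p v *_) sv) (*-zeroʳ (p v))
    ; chips-eq  = λ u → sym (trans
        (cong (λ k → chips c u ℤ.- pos (p u * deg⁺ u) ℤ.+ pos k)
          (trans (Σℕ.sum-cong-≗ (λ v → sent-*deg (rotors c) v (p v) u)) (period⇒balanced p per u)))
        (i-j+j≡i (chips c u) (pos (p u * deg⁺ u))))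
    ; rotor-eq  = λ v ns → sym (subst (λ w → iterate next (rotor (rotors c) v ns) (p v * deg⁺ w) ≡
                                             rotor (rotors c) v ns)
        (tail-rotor (rotors c) v ns)
        (iterate-* next (rotor (rotors c) v ns) (deg⁺ (tail (rotor (rotors c) v ns))) (p v)
          (iterate-deg (rotor (rotors c) v ns))))
    }

  inflow≡⇒chips≡ : Reaches r c c₁ → ∀ u → inflow (rotors c) r u ≡ r u → chips c₁ u ≡ chips c u
  inflow≡⇒chips≡ {r} {c} R u eq = trans (chips-eq R u)
    (trans (cong (λ k → chips c u ℤ.- pos (r u) ℤ.+ pos k) eq) (i-j+j≡i (chips c u) (pos (r u))))

  chips≤⇒≤inflow : Reaches r c c₁ → ∀ u → chips c u ℤ.≤ chips c₁ u → r u ≤ inflow (rotors c) r u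
  chips≤⇒≤inflow {r} {c} {c₁} R u x≤y = ℤ.drop‿+≤+ (ℤ.0≤i-j⇒j≤i
    (subst (0ℤ ℤ.≤_)
      (trans (cong (ℤ._- chips c u) (chips-eq R u)) (gain (chips c u) (pos (r u)) _))
      (ℤ.i≤j⇒0≤j-i x≤y)))
    where
    gain : ∀ x a i → x ℤ.- a ℤ.+ i ℤ.- x ≡ i ℤ.- a
    gain = solve-∀

  -- Unchanged rotors force each `r v` to consist of full turns; unchanged chips make the numbers of
  -- turns balanced.
  reaches-self⇒period : Reaches r c c → RoutingPeriodVector r
  reaches-self⇒period {r} {c} R = p , balanced⇒period p balanced , r≡
    where
    multiple : ∀ v → ∃[ k ] r v ≡ k * deg⁺ v
    multiple v with sink? v
    ... | yes sv = 0 , sink-idle R v sv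
    ... | no ns  = subst (λ w → ∃[ k ] r v ≡ k * deg⁺ w) (tail-rotor (rotors c) v ns)
                     (period⇒deg∣ (rotor (rotors c) v ns) (r v) (sym (rotor-eq R v ns)))
    p : V → ℕ
    p v = proj₁ (multiple v)
    r≡ : ∀ v → r v ≡ p v * deg⁺ v
    r≡ v = proj₂ (multiple v)
    balanced : Balanced p
    balanced u = begin
      Σℕ.sum (λ v → p v * d v u)
        ≡⟨ Σℕ.sum-cong-≗ (λ v → trans (cong (λ k → sent (rotors c) v k u) (r≡ v))
                                      (sent-*deg (rotors c) v (p v) u)) ⟨
      inflow (rotors c) r u
        ≡⟨ sum-≤-antisym (λ u → chips≤⇒≤inflow R u ℤ.≤-refl)
             (sym (sum-inflow (rotors c) r (sink-idle R))) u ⟨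
      r u            ≡⟨ r≡ u ⟩
      p u * deg⁺ u   ∎
      where open ≡-Reasoning

  -- Chips at unrouted vertices and the last edges used

  unrouted-chips : Reaches r c c₁ → ∀ u → r u ≡ 0 →
                   chips c₁ u ≡ chips c u ℤ.+ pos (inflow (rotors c) r u)
  unrouted-chips {r} {c} R u ru≡0 = trans (chips-eq R u)
    (cong (ℤ._+ pos (inflow (rotors c) r u))
      (trans (cong (λ k → chips c u ℤ.- pos k) ru≡0) (ℤ.+-identityʳ (chips c u))))

  unrouted-chips-≤ : Reaches r c c₁ → ∀ u → r u ≡ 0 → chips c u ℤ.≤ chips c₁ u
  unrouted-chips-≤ {c = c} R u ru≡0 =
    subst (chips c u ℤ.≤_) (sym (unrouted-chips R u ru≡0)) (ℤ.i≤i+j (chips c u) _)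

  unrouted-chips-< : Reaches r c c₁ → ∀ u → r u ≡ 0 → 0 < inflow (rotors c) r u →
                     chips c u ℤ.< chips c₁ u
  unrouted-chips-< {r} {c} R u ru≡0 0<in = subst₂ ℤ._<_ (ℤ.+-identityʳ (chips c u))
    (sym (unrouted-chips R u ru≡0)) (ℤ.+-monoʳ-< (chips c u) (ℤ.+<+ 0<in))

  -- Unrouted vertices never lose chips and the total number of chips is
  -- conserved, so if no routed vertex loses chips then nothing changes.
  no-loss⇒inflow≡ : Reaches r c c₁ → (∀ u → 0 < r u → chips c u ℤ.≤ chips c₁ u) →
                    ∀ u → inflow (rotors c) r u ≡ r u
  no-loss⇒inflow≡ {r} {c} {c₁} R no-loss u =
    sym (sum-≤-antisym r≤inflow (sym (sum-inflow (rotors c) r (sink-idle R))) u)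
    where
    r≤inflow : ∀ u → r u ≤ inflow (rotors c) r u
    r≤inflow u with r u in eq
    ... | zero  = z≤n
    ... | suc _ = subst (_≤ inflow (rotors c) r u) eq
                    (chips≤⇒≤inflow R u (no-loss u (subst (0 <_) (sym eq) z<s)))

  visits-last : ∀ e n → 0 < n → 0 < visits e n (head (iterate next e n))
  visits-last e (suc n) _ = filter-some (λ f → head f ≟ head (iterate next e (suc n)))
    (lose (∈-applyUpTo⁺ (λ i → iterate next e (suc i)) (n<1+n n)) refl)

  -- The final rotor of a routed vertex is the last edge it used, so a chip was sent along it.
  inflow-rotor : Reaches r c c₁ → ∀ v (ns : NonSink v) → 0 < r v →
                 0 < inflow (rotors c) r (head (rotor (rotors c₁) v ns))
  inflow-rotor {r} {c} {c₁} R v ns 0<rv = 0<sum (λ w → sent (rotors c) w (r w) u) v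
    (subst (0 <_) (sym (sent-nonSink (rotors c) v ns (r v) u))
      (subst (λ e → 0 < visits (rotor (rotors c) v ns) (r v) (head e)) (sym (rotor-eq R v ns))
        (visits-last (rotor (rotors c) v ns) (r v) 0<rv)))
    where
    u : V
    u = head (rotor (rotors c₁) v ns)

  routed-nonSink : Reaches r c c₁ → ∀ v → 0 < r v → NonSink v
  routed-nonSink R v 0<rv sv = <⇒≢ 0<rv (sym (sink-idle R v sv))

  -- Existence of a reduced vector

  rotor-eq? : ∀ (r : V → ℕ) (c c₁ : Config G) v → Dec (∀ .(ns : NonSink v) →
              rotor (rotors c₁) v ns ≡ iterate next (rotor (rotors c) v ns) (r v))
  rotor-eq? r c c₁ v with sink? v
  ... | yes sv = yes (λ ns → ⊥-elim-irr (ns sv))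
  ... | no ns with rotor (rotors c₁) v ns ≟ iterate next (rotor (rotors c) v ns) (r v)
  ...   | yes eq = yes (λ _ → eq)
  ...   | no ¬eq = no (λ eq → ¬eq (eq ns))

  reaches? : ∀ r (c c₁ : Config G) → Dec (Reaches r c c₁)
  reaches? r c c₁ = map′
    (λ (idle , chips≡ , rotor≡) → record
      { sink-idle = idle ; chips-eq = chips≡ ; rotor-eq = rotor≡ })
    (λ R → sink-idle R , chips-eq R , rotor-eq R)
    (all? idle? ×-dec
     all? (λ u → chips c₁ u ℤ.≟ _) ×-dec
     all? (rotor-eq? r c c₁))
    where
    idle? : ∀ v → Dec (Sink v → r v ≡ 0)
    idle? v with sink? v
    ... | yes sv = map′ (λ eq _ → eq) (λ f → f sv) (r v ℕ.≟ 0)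
    ... | no ns  = yes (λ sv → contradiction sv ns)

  -- Vectors of a given sum have bounded entries, so it is decidable whether one of them has the
  -- required effect, and a least such sum can be found.
  reaches-shortest : Reaches r c c₁ →
                     ∃[ s ] Reaches s c c₁ × (∀ t → Reaches t c c₁ → Σℕ.sum s ≤ Σℕ.sum t)
  reaches-shortest {r} {c} {c₁} R with least ofLength? (Σℕ.sum r) (r , refl , R)
    where
    OfLength : ℕ → (V → ℕ) → Set
    OfLength k t = Σℕ.sum t ≡ k × Reaches t c c₁
    ofLength? : ∀ k → Dec (∃[ t ] OfLength k t)
    ofLength? k = bounded-search? (suc k)
      (λ t → (Σℕ.sum t ℕ.≟ k) ×-dec reaches? t c c₁)
      (λ f≡g (len , R) → trans (sym (Σℕ.sum-cong-≗ f≡g)) len , reaches-cong f≡g R)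
      (λ {t} (len , _) i → s≤s (≤-trans (≤-sum t i) (≤-reflexive len)))
  ... | _ , (s , refl , S) , minimal =
    s , S , λ t T → ≮⇒≥ λ t<s → minimal t<s (t , refl , T)

  -- A vector of least sum is reduced: subtracting a nonzero routing period vector would keep the
  -- effect and lower the sum.
  reaches-reduced : Reaches r c c₁ → ∃[ s ] RoutingReduced s × Reaches s c c₁
  reaches-reduced {c = c} R with reaches-shortest R
  ... | s , S , minimal = s , (sink-idle S , irreducible) , S
    where
    irreducible : ∀ q → RoutingPeriodVector q → ¬ (∀ v → q v ≡ 0) → ¬ (∀ v → q v ≤ s v)
    irreducible q qper q≢0 q≤s with ¬∀⟶∃¬ #V (λ v → q v ≡ 0) (λ v → q v ℕ.≟ 0) q≢0
    ... | v , qv≢0 = <⇒≱ (sum-mono-< (λ u → m∸n≤m (s u) (q u)) v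
                            (∸-monoʳ-< (n≢0⇒n>0 qv≢0) (q≤s v)))
      (minimal (λ u → s u ∸ q u)
        (reaches-cancel (period⇒reaches-self qper c)
          (reaches-cong (λ u → sym (m+[n∸m]≡n (q≤s u))) S)))

  -- Greedy legal play

  play : ∀ n r c → Σℕ.sum r ≤ n → Reaches r c c′ → Empty (S₁ r c′) → Empty (S₂ r c′) → c ⇝ c′
  play {c′} n r c sum≤n R S₁-empty S₂-empty
    with any? (λ v → (0 <? r v) ×-dec (0ℤ ℤ.<? chips c v))
  play {c′} zero r c sum≤n R S₁-empty S₂-empty | yes (v , 0<rv , _) =
    contradiction (0<sum r v 0<rv) (≤⇒≯ sum≤n)
  play {c′} (suc n) r c sum≤n R S₁-empty S₂-empty | yes (v , 0<rv , legal) =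
    step v legal
      (play n r′ (route v c)
        (≤-pred (≤-trans (sum-mono-< r′≤r v r′v<rv) sum≤n))
        (reaches-cancel (route-reaches v c (routed-nonSink R v 0<rv))
          (reaches-cong (λ u → sym (m+[n∸m]≡n (single≤r u))) R))
        -- `S₁` and `S₂` can only shrink when the vector does, so they stay empty.
        (λ u (y<0 , 0<r′u) → S₁-empty u (y<0 , <-≤-trans 0<r′u (r′≤r u)))
        (λ u (u∈T , closed) → S₂-empty u (T-mono u∈T , λ w u→w → T-mono (closed w u→w))))
    where
    r′ : V → ℕ
    r′ u = r u ∸ single v 1 u
    r′≤r : ∀ u → r′ u ≤ r u
    r′≤r u = m∸n≤m (r u) (single v 1 u)
    single≤r : ∀ u → single v 1 u ≤ r u
    single≤r u with u ≟ v
    ... | yes refl = 0<rv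
    ... | no _     = z≤n
    r′v<rv : r′ v < r v
    r′v<rv = ∸-monoʳ-< (subst (0 <_) (sym (single-eq v 1)) z<s) (single≤r v)
    T-mono : ∀ {u} → T r′ c′ u → T r c′ u
    T-mono {u} (y≡0 , 0<r′u) = y≡0 , <-≤-trans 0<r′u (r′≤r u)
  play {c′} n r c sum≤n R S₁-empty S₂-empty | no stuck with any? (λ v → 0 <? r v)
  ... | no r≡0 = done (reaches-deterministic reaches-0
          (reaches-cong (λ v → n≤0⇒n≡0 (≮⇒≥ λ 0<rv → r≡0 (v , 0<rv))) R))
  ... | yes (v , 0<rv) = contradiction (inT v 0<rv , λ w v→w → inT w (closed v→w 0<rv)) (S₂-empty v)
    where
    x≤0 : ∀ u → 0 < r u → chips c u ℤ.≤ 0ℤ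
    x≤0 u 0<ru = ℤ.≮⇒≥ λ 0<x → stuck (u , 0<ru , 0<x)
    0≤y : ∀ u → 0 < r u → 0ℤ ℤ.≤ chips c′ u
    0≤y u 0<ru = ℤ.≮⇒≥ λ y<0 → S₁-empty u (y<0 , 0<ru)
    inflow≡r : ∀ u → inflow (rotors c) r u ≡ r u
    -- On the support of `r` the chips go from at most 0 to at least 0, so no routed vertex loses
    -- any.
    inflow≡r = no-loss⇒inflow≡ R (λ u 0<ru → ℤ.≤-trans (x≤0 u 0<ru) (0≤y u 0<ru))
    inT : ∀ u → 0 < r u → T r c′ u
    inT u 0<ru = ℤ.≤-antisym
      (subst (ℤ._≤ 0ℤ) (sym (inflow≡⇒chips≡ R u (inflow≡r u))) (x≤0 u 0<ru))
      (0≤y u 0<ru) , 0<ru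
    closed : ∀ {u w} → ReachableIn (rotors c′) u w → 0 < r u → 0 < r w
    closed ε 0<ru = 0<ru
    closed {u} ((ns , refl) ◅ path) 0<ru =
      -- The head of a final rotor receives a chip; as inflow equals `r`, that vertex lies in the
      -- support too.
      closed path (subst (0 <_) (inflow≡r _) (inflow-rotor R u ns 0<ru))

  -- Invariants of legal games

  RotorClosed : RotorConfig G → Pred V 0ℓ → Set
  RotorClosed ϱ R = ∀ u → R u → (ns : NonSink u) → R (head (rotor ϱ u ns))

  -- The last routed vertex of a rotor-closed set sends its chip inside the set,
  -- where the chip then stays.  The set may contain vertices that have not been
  -- routed, provided they start without debt.
  NoChiplessClosedSet : (V → ℕ) → Config G → Config G → Set₁
  NoChiplessClosedSet s c c′ =
    ∀ (R : Pred V 0ℓ) → RotorClosed (rotors c′) R →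
    (∀ u → R u → 0 < s u ⊎ 0ℤ ℤ.≤ chips c u) →
    (∀ u → R u → chips c′ u ≡ 0ℤ) →
    ∀ u → R u → ¬ 0 < s u

  -- `nonNegative` serves to empty `S₁`, and `noChipless` to empty `S₂`. Both involve only the
  -- support of `s`, so they also apply to a vector with smaller support.
  record LegalRouting (s : V → ℕ) (c c′ : Config G) : Set₁ where
    field
      reaches     : Reaches s c c′
      nonNegative : ∀ u → 0 < s u → 0ℤ ℤ.≤ chips c′ u
      noChipless  : NoChiplessClosedSet s c c′

  legalRouting-step : ∀ v → NonSink v → Legal v c → LegalRouting s (route v c) c′ →
                      LegalRouting (λ u → single v 1 u + s u) c c′
  legalRouting-step {c} {s} {c′} v ns legal rest = record
    { reaches     = reaches-+ first (reaches rest)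
    ; nonNegative = nonNeg
    ; noChipless  = chipless
    }
    where
    open LegalRouting
    c⁺ : Config G
    c⁺ = route v c
    first : Reaches (single v 1) c c⁺
    first = route-reaches v c ns

    -- Legality provides at least one chip, and exactly one is given away.
    0≤c⁺v : 0ℤ ℤ.≤ chips c⁺ v
    0≤c⁺v = subst (0ℤ ℤ.≤_)
      (sym (trans (chips-eq first v)
        (cong (λ k → chips c v ℤ.- pos k ℤ.+ pos (inflow (rotors c) (single v 1) v)) (single-eq v 1))))
      (ℤ.≤-trans (ℤ.i≤j⇒0≤j-i (ℤ.i<j⇒suc[i]≤j legal)) (ℤ.i≤i+j _ _))

    routed-later : ∀ {u} → u ≢ v → 0 < single v 1 u + s u → 0 < s u
    routed-later {u} u≢v = subst (λ k → 0 < k + s u) (single-≢ v 1 u≢v)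

    nonNeg : ∀ u → 0 < single v 1 u + s u → 0ℤ ℤ.≤ chips c′ u
    nonNeg u 0<su with 0 <? s u
    ... | yes 0<su = nonNegative rest u 0<su
    ... | no  ¬0<su with u ≟ v
    ...   | no u≢v   = contradiction 0<su ¬0<su
    ...   | yes refl = ℤ.≤-trans 0≤c⁺v
                         (unrouted-chips-≤ (reaches rest) u (n≤0⇒n≡0 (≮⇒≥ ¬0<su)))

    chipless : NoChiplessClosedSet (λ u → single v 1 u + s u) c c′
    chipless R closed noDebt zero′ u u∈R 0<su =
      noChipless rest R closed noDebt₁ zero′ u u∈R
        (routed-later (λ u≡v → v∉R (subst R u≡v u∈R)) 0<su)
      where
      -- The vertex `v` may never be routed again, but it is free of debt after its legal move; this
      -- is where the second alternative of the hypothesis is needed.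
      noDebt₁ : ∀ u → R u → 0 < s u ⊎ 0ℤ ℤ.≤ chips c⁺ u
      noDebt₁ u u∈R with u ≟ v
      ... | yes refl = inj₂ 0≤c⁺v
      ... | no  u≢v with noDebt u u∈R
      ...   | inj₁ 0<su = inj₁ (routed-later u≢v 0<su)
      ...   | inj₂ 0≤x  = inj₂ (ℤ.≤-trans 0≤x (unrouted-chips-≤ first u (single-≢ v 1 u≢v)))

      unrouted : ∀ u → R u → s u ≡ 0
      unrouted u u∈R = n≤0⇒n≡0 (≮⇒≥ (noChipless rest R closed noDebt₁ zero′ u u∈R))

      -- Otherwise this routing at `v` is the last one inside `R`. The rotor of `v` then stays
      -- fixed, so the chip goes to a vertex `w` of `R`, which starts without debt and never gives
      -- the chip away, contradicting that `R` ends chipless.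
      v∉R : ¬ R v
      v∉R v∈R = ℤ.<-irrefl (sym (zero′ w w∈R)) 0<c′w
        where
        w : V
        w = head (rotor (rotors c′) v ns)
        w∈R : R w
        w∈R = closed v v∈R ns
        w≢v : w ≢ v
        w≢v w≡v = loopless (rotor (rotors c′) v ns) (trans (tail-rotor (rotors c′) v ns) (sym w≡v))
        w≡ : head (rotor (rotors c⁺) v ns) ≡ w
        w≡ = cong head (sym (trans (rotor-eq (reaches rest) v ns)
               (cong (iterate next (rotor (rotors c⁺) v ns)) (unrouted v v∈R))))
        0≤cw : 0ℤ ℤ.≤ chips c w
        0≤cw with noDebt w w∈R
        ... | inj₁ 0<sw = contradiction (sym (unrouted w w∈R)) (<⇒≢ (routed-later w≢v 0<sw))
        ... | inj₂ 0≤x  = 0≤x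
        0<c′w : 0ℤ ℤ.< chips c′ w
        0<c′w = ℤ.≤-<-trans 0≤cw (ℤ.<-≤-trans
          (unrouted-chips-< first w (single-≢ v 1 w≢v)
            (subst (λ w → 0 < inflow (rotors c) (single v 1) w) w≡
              (inflow-rotor first v ns (subst (0 <_) (sym (single-eq v 1)) z<s))))
          (unrouted-chips-≤ (reaches rest) w (unrouted w w∈R)))

  legalRouting : c ⇝ c′ → ∃[ s ] LegalRouting s c c′
  legalRouting (done c≈c′) = (λ _ → 0) , record
    { reaches     = reaches-resp-≈ c≈c′ reaches-0
    ; nonNegative = λ _ ()
    ; noChipless  = λ _ _ _ _ _ _ ()
    }
  legalRouting {c} {c′} (step v legal game) with legalRouting game | sink? v
  -- A move at a sink has no effect and is not counted, so `s` stays zero at sinks.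
  ... | s , rest | yes sv = s , subst (λ c → LegalRouting s c c′) (route-sink v c sv) rest
  ... | s , rest | no ns  = _ , legalRouting-step v ns legal rest

  -- Comparison of the reduced vector with a legal game

  excess : ∀ m n → 0 < m ∸ (m ⊓ n) → n ∸ (m ⊓ n) ≡ 0
  excess m n 0< with ≤-total m n
  ... | inj₁ m≤n rewrite m≤n⇒m⊓n≡m m≤n | n∸n≡0 m = contradiction 0< λ ()
  ... | inj₂ n≤m rewrite m≥n⇒m⊓n≡n n≤m = n∸n≡0 n

  -- After routing the common part of r and s, the remaining routings are
  -- disjoint and lead to the same configuration.
  reduced-support : RoutingReduced r → Reaches r c c′ → Reaches s c c′ → ∀ v → 0 < r v → 0 < s v
  -- If `s v` were 0, then `a v` would equal `r v`, so `a` would be a nonzero routing period vector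
  -- below `r`.
  reduced-support {r} {c} {c′} {s} (idle , irreducible) R S v 0<rv = ≰⇒> λ sv≤0 →
    irreducible a (reaches-self⇒period (reaches-resp-≈ c′≈c₀ R∸m))
      (λ a≡0 → <⇒≢ 0<rv (sym (trans
        (cong (r v ∸_) (sym (trans (cong (r v ⊓_) (n≤0⇒n≡0 sv≤0)) (⊓-zeroʳ (r v))))) (a≡0 v))))
      (λ u → m∸n≤m (r u) (m u))
    where
    m a b : V → ℕ
    m u = r u ⊓ s u
    a u = r u ∸ m u
    b u = s u ∸ m u
    c₀ : Config G
    c₀ = π m c
    M : Reaches m c c₀
    M = reaches-cong (clip-id (λ u su → cong (_⊓ s u) (idle u su))) (π-reaches m c)
    R∸m : Reaches a c₀ c′
    R∸m = reaches-cancel M (reaches-cong (λ u → sym (m+[n∸m]≡n (m⊓n≤m (r u) (s u)))) R)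
    S∸m : Reaches b c₀ c′
    S∸m = reaches-cancel M (reaches-cong (λ u → sym (m+[n∸m]≡n (m⊓n≤n (r u) (s u)))) S)
    inflow≡a : ∀ u → inflow (rotors c₀) a u ≡ a u
    -- A vertex routed by `a` is unrouted by `b`, and `b` has the same effect; so it cannot lose
    -- chips.
    inflow≡a = no-loss⇒inflow≡ R∸m (λ u 0<au → unrouted-chips-≤ S∸m u (excess (r u) (s u) 0<au))
    rotor≡ : ∀ u .(ns : NonSink u) → rotor (rotors c′) u ns ≡ rotor (rotors c₀) u ns
    rotor≡ u ns with 0 <? a u
    ... | yes 0<au = trans (rotor-eq S∸m u ns)
                       (cong (iterate next (rotor (rotors c₀) u ns)) (excess (r u) (s u) 0<au))
    ... | no ¬0<au = trans (rotor-eq R∸m u ns)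
                       (cong (iterate next (rotor (rotors c₀) u ns)) (n≤0⇒n≡0 (≮⇒≥ ¬0<au)))
    c′≈c₀ : c′ ≈ c₀
    c′≈c₀ = (λ u → inflow≡⇒chips≡ R∸m u (inflow≡a u)) , rotor≡

theorem3p4 : (G : RibbonDigraph) → let open RibbonDigraph G in
    (c c′ : Config G) →
    c ⇝ c′ ⇔
    (UnconstrainedReachable c c′ ×
    ((r : V → ℕ) → RoutingReduced r → π r c ≈ c′ →
    Empty (S₁ r c′) × Empty (S₂ r c′)))
theorem3p4 G c c′ = mk⇔ legal⇒ ⇒legal
  where
  open RibbonDigraph G
  open Routing G
  open Legality G
  open LegalRouting
  open Config

  legal⇒ : c ⇝ c′ → UnconstrainedReachable c c′ ×
           ((r : V → ℕ) → RoutingReduced r → π r c ≈ c′ → Empty (S₁ r c′) × Empty (S₂ r c′))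
  legal⇒ game with legalRouting game
  ... | s , played = (s , reaches⇒π≈ (reaches played)) , λ r red πr≈c′ →
    let routed = reduced-support red
                   (reaches-cong (clip-id (proj₁ red)) (π≈⇒reaches r c c′ πr≈c′)) (reaches played)
    in
    (λ v (y<0 , 0<rv) → ℤ.<⇒≱ y<0 (nonNegative played v (routed v 0<rv))) ,
    (λ v ((_ , 0<rv) , inT) →
      -- The set reachable from `v` is rotor-closed; for `v` in `S₂` its members are all routed in
      -- the game and chipless at the end.
      noChipless played (ReachableIn (rotors c′) v)
        (λ u v→u ns → v→u ◅◅ ((ns , refl) ◅ ε))
        (λ u v→u → inj₁ (routed u (proj₂ (inT u v→u))))
        (λ u v→u → proj₁ (inT u v→u))
        v ε (routed v 0<rv))

  ⇒legal : UnconstrainedReachable c c′ ×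
           ((r : V → ℕ) → RoutingReduced r → π r c ≈ c′ → Empty (S₁ r c′) × Empty (S₂ r c′)) →
           c ⇝ c′
  -- The given `r₀` need not be reduced, while the emptiness conditions are available only for
  -- reduced vectors.
  ⇒legal ((r₀ , πr₀≈c′) , empty) with reaches-reduced (π≈⇒reaches r₀ c c′ πr₀≈c′)
  ... | r , red , R with empty r red (reaches⇒π≈ R)
  ...   | S₁-empty , S₂-empty = play (Σℕ.sum r) r c ≤-refl R S₁-empty S₂-empty
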